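{- Every self-complementary, edge-transitive and vertex-transitive (finite simple) graph $G$ satisfies $\operatorname{tww}(G)=\operatorname{lb}_1(G)$.
   Context: A graph is self-complementary if it is isomorphic to its complement; vertex-/edge-transitive if its automorphism group acts transitively on vertices/edges. A trigraph is a graph whose edges are colored red or black; a graph is a trigraph with all edges black. For a partition $\mathcal{P}$ of $V(G)$, the quotient trigraph $G/\mathcal{P}$ has vertex set $\mathcal{P}$; two parts $U,W$ are joined by a black edge if every pair $u\in U,w\in W$ is a black edge, are non-adjacent if no such pair is an edge, and are joined by a red edge otherwise. A contraction sequence of an $n$-vertex trigraph $G$ is a sequence $\mathcal{P}_n,\dots,\mathcal{P}_1$ of partitions with $\mathcal{P}_n$ discrete and each $\mathcal{P}_i$ obtained from $\mathcal{P}_{i+1}$ by merging two parts; its width is the maximum red degree over all $G/\mathcal{P}_i$; $\operatorname{tww}(G)$ is the minimum width. For $G$ with at least two vertices, $\operatorname{lb}_1(G)$ is the minimum, over all pairs of distinct vertices $u,v$, of the maximum red degree of $G/\mathcal{P}$ where $\mathcal{P}$ has $\{u,v\}$ as its only non-singleton part; for a one-vertex graph $\operatorname{lb}_1(G)=0$. (A graph with $\operatorname{tww}(G)=\operatorname{lb}_1(G)$ is called $\operatorname{lb}_1$-collapsible.) -}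

module Defs where

open import Data.Nat using (ℕ; zero; suc; _≤_; _⊔_)
open import Data.Bool using (Bool; true; false; _∧_; not; if_then_else_)
open import Data.Fin using (Fin; zero; suc; fromℕ; inject₁; _≟_)
open import Data.Fin.Permutation using (Permutation′; _⟨$⟩ʳ_)
open import Data.List using (List; allFin; map; foldr)
open import Data.Bool.ListAction using (any)
open import Data.Nat.ListAction using (sum)
open import Data.Product using (Σ; _×_; ∃; ∃-syntax; _,_)
open import Data.Sum using (_⊎_)
open import Relation.Nullary using (¬_)
open import Relation.Nullary.Decidable using (⌊_⌋)
open import Relation.Binary.PropositionalEquality using (_≡_; _≢_)
open import Function.Bundles using (_⇔_)

record Graph (n : ℕ) : Set where
  field
    adj    : Fin n → Fin n → Bool
    sym    : ∀ x y → adj x y ≡ adj y x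
    irrefl : ∀ x → adj x x ≡ false
open Graph public

coAdj : ∀ {n} → Graph n → Fin n → Fin n → Bool
coAdj G x y = not ⌊ x ≟ y ⌋ ∧ not (adj G x y)

SelfComplementary : ∀ {n} → Graph n → Set
SelfComplementary {n} G =
  Σ (Permutation′ n) λ σ → ∀ x y → coAdj G (σ ⟨$⟩ʳ x) (σ ⟨$⟩ʳ y) ≡ adj G x y

IsAutomorphism : ∀ {n} → Graph n → Permutation′ n → Set
IsAutomorphism G σ = ∀ x y → adj G (σ ⟨$⟩ʳ x) (σ ⟨$⟩ʳ y) ≡ adj G x y

VertexTransitive : ∀ {n} → Graph n → Set
VertexTransitive {n} G =
  ∀ x y → Σ (Permutation′ n) λ σ → IsAutomorphism G σ × σ ⟨$⟩ʳ x ≡ y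

-- edges are unordered pairs {u,v}
EdgeTransitive : ∀ {n} → Graph n → Set
EdgeTransitive {n} G =
  ∀ u v x y → adj G u v ≡ true → adj G x y ≡ true →
  Σ (Permutation′ n) λ σ → IsAutomorphism G σ ×
    ((σ ⟨$⟩ʳ u ≡ x × σ ⟨$⟩ʳ v ≡ y) ⊎ (σ ⟨$⟩ʳ u ≡ y × σ ⟨$⟩ʳ v ≡ x))

-- Partitions of Fin n, presented by a labelling: the parts are the
-- nonempty fibres of the labelling function.

Labelling : ℕ → Set
Labelling n = Fin n → Fin n

anyFin : ∀ {n} → (Fin n → Bool) → Bool
anyFin {n} p = any p (allFin n)

countFin : ∀ {n} → (Fin n → Bool) → ℕ
countFin {n} p = sum (map (λ i → if p i then 1 else 0) (allFin n))

maxFin : ∀ {n} → (Fin n → ℕ) → ℕ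
maxFin {n} f = foldr _⊔_ 0 (map f (allFin n))

-- parts labelled a and b are distinct and joined by a red edge in G/P:
-- some pair between them is an edge and some pair is a non-edge
-- (G is a graph, so all its edges are black)
redEdge : ∀ {n} → Graph n → Labelling n → Fin n → Fin n → Bool
redEdge G f a b =
  not ⌊ a ≟ b ⌋
  ∧ anyFin (λ u → anyFin (λ w → ⌊ f u ≟ a ⌋ ∧ ⌊ f w ≟ b ⌋ ∧ adj G u w))
  ∧ anyFin (λ u → anyFin (λ w → ⌊ f u ≟ a ⌋ ∧ ⌊ f w ≟ b ⌋ ∧ not (adj G u w)))

redDegree : ∀ {n} → Graph n → Labelling n → Fin n → ℕ
redDegree G f a = countFin (λ b → redEdge G f a b)

maxRedDegree : ∀ {n} → Graph n → Labelling n → ℕ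
maxRedDegree G f = maxFin (redDegree G f)

Discrete : ∀ {n} → Labelling n → Set
Discrete {n} f = ∀ x y → f x ≡ f y → x ≡ y

MergeStep : ∀ {n} → Labelling n → Labelling n → Set
MergeStep {n} f g =
  ∃[ u ] ∃[ v ] (f u ≢ f v × (∀ x y →
     (g x ≡ g y) ⇔ (f x ≡ f y ⊎ (f x ≡ f u × f y ≡ f v) ⊎ (f x ≡ f v × f y ≡ f u))))

-- A contraction sequence P_{n+1}, ..., P_1 of an (n+1)-vertex graph:
-- partitions i : Fin (suc n) stands for P_{i+1}.
record ContractionSequence (n : ℕ) : Set where
  field
    part     : Fin (suc n) → Labelling (suc n)
    discrete : Discrete (part (fromℕ n))
    steps    : ∀ (i : Fin n) → MergeStep (part (suc i)) (part (inject₁ i))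
open ContractionSequence public

width≤ : ∀ {n} → Graph (suc n) → ContractionSequence n → ℕ → Set
width≤ {n} G S d = ∀ (i : Fin (suc n)) → maxRedDegree G (part S i) ≤ d

IsTww : ∀ {n} → Graph (suc n) → ℕ → Set
IsTww {n} G t =
  (Σ (ContractionSequence n) λ S → width≤ G S t) ×
  (∀ (S : ContractionSequence n) (d : ℕ) → width≤ G S d → t ≤ d)

mergePair : ∀ {n} → Fin n → Fin n → Labelling n
mergePair u v x = if ⌊ x ≟ v ⌋ then u else x

IsLb1 : ∀ {n} → Graph (suc n) → ℕ → Set
IsLb1 {n} G t =
  (n ≡ 0 → t ≡ 0) ×
  (1 ≤ n →
     (∃[ u ] ∃[ v ] (u ≢ v × maxRedDegree G (mergePair u v) ≡ t)) ×
     (∀ u v → u ≢ v → t ≤ maxRedDegree G (mergePair u v)))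

{-# OPTIONS --safe #-}
module Submission where

-- Call w a distinguisher of u ≠ v if w ∉ {u , v} is adjacent to exactly one of them.
-- Edge-transitivity and a complementing permutation make the number of distinguishers
-- the same for all pairs, and double counting shows that it equals the valency r, where
-- n = 2 r + 1.  Hence lb₁ = r, and every first contraction costs r.
--
-- For the upper bound take a complementing permutation ρ of 2-power order.  Its cycles
-- have length 1 (at most once) or at least 4; match every other vertex with its antipode
-- on its cycle, and contract the matched pairs, those on longer cycles first.  The power
-- of ρ that swaps x and its mate x′ is an automorphism which swaps the pairs on cycles of
-- the same length and fixes all vertices on shorter cycles.  Therefore, until a pair on a
-- shorter cycle has been contracted, every red neighbour of {x , x′} contains a
-- distinguisher of x and x′, so there are at most r; from then on all red neighbours of
-- {x , x′} are contracted pairs, so again there are at most r.  Red neighbours of an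
-- uncontracted x lie on cycles of the same length and are bounded in the first way.
-- After the last pair r + 1 parts remain, and any order of contraction will do.

open import Defs renaming (sym to adj-sym)
open import Data.Bool using (Bool; true; false; _∧_; _xor_; not; if_then_else_) renaming (_≟_ to _≟ᵇ_)
open import Data.Bool.Properties using (T-≡; not-¬; not-involutive; not-injective)
open import Data.Empty using (⊥; ⊥-elim)
open import Data.Fin using (Fin; zero; suc; fromℕ; inject₁; toℕ; _≟_)
open import Data.Fin.Permutation using (Permutation′; _⟨$⟩ʳ_)
open import Data.Fin.Properties using (any?; pigeonhole; suc-injective; 0≢1+n; toℕ<n)
open import Data.List using ([]; _∷_; allFin; map; foldr; tabulate)
open import Data.List.Membership.Propositional using (lose)
open import Data.List.Membership.Propositional.Properties using (∈-allFin)
open import Data.List.Properties using (map-tabulate)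
open import Data.List.Relation.Unary.Any using (Any; here; there; satisfied)
open import Data.List.Relation.Unary.Any.Properties using (any⁺; any⁻)
open import Data.Nat using (ℕ; zero; suc; _+_; _*_; _∸_; _^_; _!; _≤_; _<_; _≤′_; ≤′-refl; ≤′-step; _⊔_; z≤n; s≤s)
open import Data.Nat.Divisibility using (divides; ∣-trans; m∣m*n; m≤n⇒m!∣n!)
open import Data.Nat.GeneralisedArithmetic using (fold; fold-+)
import Data.Nat.ListAction as ListAction
open import Data.Nat.Properties as ℕₚ using (+-0-commutativeMonoid)
open import Data.Product using (Σ; _×_; ∃; ∃-syntax; _,_; proj₁; proj₂)
open import Data.Sum using (_⊎_; inj₁; inj₂)
open import Function using (_∘_; id; Equivalence; Injection; Injective; mk⇔)
open import Function.Properties.Inverse using (↔⇒↣)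
open import Relation.Binary.PropositionalEquality
open import Relation.Nullary using (¬_; Dec; yes; no; contradiction)
open import Relation.Nullary.Decidable using (⌊_⌋; ¬?; _×-dec_; decidable-stable)
open import Algebra.Properties.CommutativeMonoid.Sum +-0-commutativeMonoid
  using (sum-cong-≗; ∑-distrib-+; ∑-comm; sum-permute; sum-replicate-zero) renaming (sum to ∑)

-- Counting over Fin n

∧-split : ∀ {x y} → x ∧ y ≡ true → x ≡ true × y ≡ true
∧-split {true} {true} refl = refl , refl

∧-join : ∀ {x y} → x ≡ true → y ≡ true → x ∧ y ≡ true
∧-join refl refl = refl

not-true : ∀ {x} → not x ≡ true → x ≡ false
not-true {false} refl = refl

not-join : ∀ {x} → x ≡ false → not x ≡ true
not-join refl = refl

clash : ∀ {x} {A : Set} → x ≡ true → x ≡ false → A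
clash refl ()

≟-sound : ∀ {n} {x y : Fin n} → ⌊ x ≟ y ⌋ ≡ true → x ≡ y
≟-sound {x = x} {y} e with x ≟ y
... | yes p = p

≟-complete : ∀ {n} {x y : Fin n} → x ≡ y → ⌊ x ≟ y ⌋ ≡ true
≟-complete {x = x} {y} e with x ≟ y
... | yes _ = refl
... | no ¬p = contradiction e ¬p

≢-sound : ∀ {n} {x y : Fin n} → not ⌊ x ≟ y ⌋ ≡ true → x ≢ y
≢-sound {x = x} {y} e with x ≟ y
... | no ¬p = ¬p

≢-complete : ∀ {n} {x y : Fin n} → x ≢ y → ⌊ x ≟ y ⌋ ≡ false
≢-complete {x = x} {y} ne with x ≟ y
... | yes p = contradiction p ne
... | no _ = refl

≢-not : ∀ {n} {x y : Fin n} → x ≢ y → not ⌊ x ≟ y ⌋ ≡ true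
≢-not ne = not-join (≢-complete ne)

anyFin-sound : ∀ {n} (p : Fin n → Bool) → anyFin p ≡ true → ∃[ x ] p x ≡ true
anyFin-sound {n} p e
  with x , t ← satisfied (any⁻ p (allFin n) (Equivalence.from T-≡ e)) = x , Equivalence.to T-≡ t

anyFin-complete : ∀ {n} (p : Fin n → Bool) x → p x ≡ true → anyFin p ≡ true
anyFin-complete p x e =
  Equivalence.to T-≡ (any⁺ p (lose (∈-allFin x) (Equivalence.from T-≡ e)))

χ : Bool → ℕ
χ b = if b then 1 else 0

countFin-∑ : ∀ {n} (p : Fin n → Bool) → countFin p ≡ ∑ (χ ∘ p)
countFin-∑ p = trans (cong ListAction.sum (map-tabulate id (χ ∘ p))) (go (χ ∘ p))
  where
  go : ∀ {n} (f : Fin n → ℕ) → ListAction.sum (tabulate f) ≡ ∑ f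
  go {zero}  f = refl
  go {suc n} f = cong (f zero +_) (go (f ∘ suc))

∑-mono : ∀ {n} {f g : Fin n → ℕ} → (∀ i → f i ≤ g i) → ∑ f ≤ ∑ g
∑-mono {zero}  h = z≤n
∑-mono {suc n} h = ℕₚ.+-mono-≤ (h zero) (∑-mono (h ∘ suc))

∑-const : ∀ n c → ∑ {n} (λ _ → c) ≡ n * c
∑-const zero    c = refl
∑-const (suc n) c = cong (c +_) (∑-const n c)

∑-member : ∀ {n} (f : Fin n → ℕ) i → f i ≤ ∑ f
∑-member f zero    = ℕₚ.m≤m+n _ _
∑-member f (suc i) = ℕₚ.≤-trans (∑-member (f ∘ suc) i) (ℕₚ.m≤n+m _ _)

∑-zero : ∀ {n} {f : Fin n → ℕ} → (∀ i → f i ≡ 0) → ∑ f ≡ 0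
∑-zero {n} h = trans (sum-cong-≗ h) (sum-replicate-zero n)

χ-mono : ∀ {x y} → (x ≡ true → y ≡ true) → χ x ≤ χ y
χ-mono {false} h = z≤n
χ-mono {true}  h = ℕₚ.≤-reflexive (cong χ (sym (h refl)))

χ-≢true : ∀ {x} → ¬ (x ≡ true) → χ x ≡ 0
χ-≢true {false} h = refl
χ-≢true {true}  h = contradiction refl h

∑-atMostOne : ∀ {n} (p : Fin n → Bool) →
  (∀ i j → p i ≡ true → p j ≡ true → i ≡ j) → ∑ (χ ∘ p) ≤ 1
∑-atMostOne {zero}  p h = z≤n
∑-atMostOne {suc n} p h with p zero in eq
... | false = ∑-atMostOne (p ∘ suc) (λ i j pi pj → suc-injective (h (suc i) (suc j) pi pj))
... | true = s≤s (ℕₚ.≤-reflexive (∑-zero (λ i → χ-≢true (λ pi → 0≢1+n (h zero (suc i) eq pi)))))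

∑-singleton : ∀ {n} (a : Fin n) → ∑ (λ i → χ ⌊ i ≟ a ⌋) ≡ 1
∑-singleton a = ℕₚ.≤-antisym
  (∑-atMostOne (λ i → ⌊ i ≟ a ⌋) (λ i j ei ej → trans (≟-sound ei) (sym (≟-sound ej))))
  (ℕₚ.≤-trans (ℕₚ.≤-reflexive (cong χ (sym (≟-complete {x = a} refl)))) (∑-member (λ i → χ ⌊ i ≟ a ⌋) a))

-- Double counting of the pairs (b , choice b): each b with p b contributes
-- at least one pair, and each u with q u lies in at most one.
count-inj : ∀ {m n} (p : Fin m → Bool) (q : Fin n → Bool) (R : Fin m → Fin n → Set) →
  (∀ b → p b ≡ true → ∃[ u ] (q u ≡ true × R b u)) →
  (∀ {b c u} → R b u → R c u → b ≡ c) →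
  countFin p ≤ countFin q
count-inj {m} {n} p q R h inj = begin
  countFin p                          ≡⟨ countFin-∑ p ⟩
  ∑ (λ b → χ (p b))                   ≤⟨ ∑-mono row ⟩
  ∑ (λ b → ∑ (λ u → χ (chosen b u)))  ≡⟨ ∑-comm (λ b u → χ (chosen b u)) ⟩
  ∑ (λ u → ∑ (λ b → χ (chosen b u)))  ≤⟨ ∑-mono column ⟩
  ∑ (λ u → χ (q u))                   ≡⟨ countFin-∑ q ⟨
  countFin q                          ∎
  where
  open ℕₚ.≤-Reasoning
  -- The value of `p b` travels together with its equation, so that a case split on it still gives
  -- access to the witness in `h b e`.
  choose : ∀ b x → p b ≡ x → Fin n → Bool
  choose b false e u = false
  choose b true  e u = ⌊ proj₁ (h b e) ≟ u ⌋

  chosen : Fin m → Fin n → Bool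
  chosen b = choose b (p b) refl

  chosen-R : ∀ b x (e : p b ≡ x) u → choose b x e u ≡ true → q u ≡ true × R b u
  chosen-R b true e u eu with refl ← ≟-sound eu = proj₂ (h b e)

  row : ∀ b → χ (p b) ≤ ∑ (λ u → χ (chosen b u))
  row b = go (p b) refl
    where
    go : ∀ x (e : p b ≡ x) → χ x ≤ ∑ (λ u → χ (choose b x e u))
    go false e = z≤n
    go true  e = ℕₚ.≤-trans (ℕₚ.≤-reflexive (cong χ (sym (≟-complete refl))))
      (∑-member (λ u → χ (choose b true e u)) (proj₁ (h b e)))

  column : ∀ u → ∑ (λ b → χ (chosen b u)) ≤ χ (q u)
  column u with q u in eq
  ... | true  = ∑-atMostOne _ (λ b c eb ec →
                  inj (proj₂ (chosen-R b (p b) refl u eb)) (proj₂ (chosen-R c (p c) refl u ec)))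
  ... | false = ℕₚ.≤-reflexive (∑-zero (λ b → χ-≢true (λ eb →
                  clash (proj₁ (chosen-R b (p b) refl u eb)) eq)))

count-none : ∀ {n} (p : Fin n → Bool) → (∀ b → ¬ (p b ≡ true)) → countFin p ≡ 0
count-none p h = trans (countFin-∑ p) (∑-zero (χ-≢true ∘ h))

count-cong : ∀ {n} {p q : Fin n → Bool} → (∀ b → p b ≡ q b) → countFin p ≡ countFin q
count-cong {p = p} {q} h =
  trans (countFin-∑ p) (trans (sum-cong-≗ (cong χ ∘ h)) (sym (countFin-∑ q)))

count-permute : ∀ {n} (p : Fin n → Bool) (σ : Permutation′ n) →
  countFin p ≡ countFin (λ x → p (σ ⟨$⟩ʳ x))
count-permute p σ = trans (countFin-∑ p) (trans (sum-permute (χ ∘ p) σ) (sym (countFin-∑ (λ x → p (σ ⟨$⟩ʳ x)))))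

-- Meant for red degrees: a label with a red edge is the label of some vertex, so only labels in use
-- need a bound.
count-≤-if-inhabited : ∀ {n} (p : Fin n → Bool) {c} →
  (∀ b → p b ≡ true → countFin p ≤ c) → countFin p ≤ c
count-≤-if-inhabited p {c} h with any? (λ b → p b ≟ᵇ true)
... | yes (b , pb) = h b pb
... | no none      = subst (_≤ c) (sym (count-none p (λ b pb → none (b , pb)))) z≤n

count-disjoint : ∀ {n} (p q : Fin n → Bool) →
  (∀ b → p b ≡ true → q b ≡ true → ⊥) → countFin p + countFin q ≤ n
count-disjoint {n} p q h = begin
  countFin p + countFin q      ≡⟨ cong₂ _+_ (countFin-∑ p) (countFin-∑ q) ⟩
  ∑ (χ ∘ p) + ∑ (χ ∘ q)        ≡⟨ ∑-distrib-+ (χ ∘ p) (χ ∘ q) ⟨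
  ∑ (λ b → χ (p b) + χ (q b))  ≤⟨ ∑-mono bound ⟩
  ∑ {n} (λ _ → 1)              ≡⟨ ∑-const n 1 ⟩
  n * 1                        ≡⟨ ℕₚ.*-identityʳ n ⟩
  n                            ∎
  where
  open ℕₚ.≤-Reasoning
  bound : ∀ b → χ (p b) + χ (q b) ≤ 1
  bound b with p b in ep | q b in eq
  ... | false | false = z≤n
  ... | false | true  = s≤s z≤n
  ... | true  | false = s≤s z≤n
  ... | true  | true  = ⊥-elim (h b ep eq)

maxFin-least : ∀ {n} (f : Fin n → ℕ) {c} → (∀ i → f i ≤ c) → maxFin f ≤ c
maxFin-least {n} f {c} h = go (allFin n)
  where
  go : ∀ is → foldr _⊔_ 0 (map f is) ≤ c
  go []       = z≤n
  go (i ∷ is) = ℕₚ.⊔-lub (h i) (go is)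

maxFin-upper : ∀ {n} (f : Fin n → ℕ) i → f i ≤ maxFin f
maxFin-upper {n} f i = go (∈-allFin i)
  where
  go : ∀ {is} → Any (i ≡_) is → f i ≤ foldr _⊔_ 0 (map f is)
  go (here refl) = ℕₚ.m≤m⊔n _ _
  go (there i∈)  = ℕₚ.≤-trans (go i∈) (ℕₚ.m≤n⊔m _ _)

-- Red degrees and contraction chains

-- Subscript 1 marks the pair that is an edge, subscript 0 the pair that is not.
record RedEdge {n} (G : Graph n) (f : Labelling n) (a b : Fin n) : Set where
  constructor redEdge-witness
  field
    a≢b      : a ≢ b
    u₁ w₁    : Fin n
    fu₁      : f u₁ ≡ a
    fw₁      : f w₁ ≡ b
    edge     : adj G u₁ w₁ ≡ true
    u₀ w₀    : Fin n
    fu₀      : f u₀ ≡ a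
    fw₀      : f w₀ ≡ b
    non-edge : adj G u₀ w₀ ≡ false

redEdge-sound : ∀ {n} (G : Graph n) f a b → redEdge G f a b ≡ true → RedEdge G f a b
redEdge-sound G f a b e
  with a≢b , e′ ← ∧-split e
  with e₁ , e₀ ← ∧-split e′
  with u₁ , e₁ ← anyFin-sound _ e₁
  with w₁ , e₁ ← anyFin-sound _ e₁
  with u₀ , e₀ ← anyFin-sound _ e₀
  with w₀ , e₀ ← anyFin-sound _ e₀
  with fu₁ , e₁ ← ∧-split e₁
  with fw₁ , e₁ ← ∧-split e₁
  with fu₀ , e₀ ← ∧-split e₀
  with fw₀ , e₀ ← ∧-split e₀
  = redEdge-witness (≢-sound a≢b) u₁ w₁ (≟-sound fu₁) (≟-sound fw₁) e₁
      u₀ w₀ (≟-sound fu₀) (≟-sound fw₀) (not-true e₀)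

redEdge-complete : ∀ {n} (G : Graph n) f a b → RedEdge G f a b → redEdge G f a b ≡ true
redEdge-complete G f a b (redEdge-witness a≢b u₁ w₁ fu₁ fw₁ e₁ u₀ w₀ fu₀ fw₀ e₀) =
  ∧-join (≢-not a≢b) (∧-join
    (anyFin-complete _ u₁ (anyFin-complete _ w₁
      (∧-join (≟-complete fu₁) (∧-join (≟-complete fw₁) e₁))))
    (anyFin-complete _ u₀ (anyFin-complete _ w₀
      (∧-join (≟-complete fu₀) (∧-join (≟-complete fw₀) (not-join e₀))))))

-- Labels in use and the effect of a merge

isLabel : ∀ {n} → Labelling n → Fin n → Bool
isLabel f b = anyFin (λ x → ⌊ f x ≟ b ⌋)

isLabel-sound : ∀ {n} (f : Labelling n) b → isLabel f b ≡ true → ∃[ x ] f x ≡ b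
isLabel-sound f b e with x , ex ← anyFin-sound _ e = x , ≟-sound ex

isLabel-complete : ∀ {n} (f : Labelling n) {b} x → f x ≡ b → isLabel f b ≡ true
isLabel-complete f x e = anyFin-complete _ x (≟-complete e)

parts : ∀ {n} → Labelling n → ℕ
parts f = countFin (isLabel f)

parts-id : ∀ n → parts {n} id ≡ n
parts-id n = begin
  parts {n} id           ≡⟨ countFin-∑ {n} (isLabel id) ⟩
  ∑ {n} (χ ∘ isLabel id) ≡⟨ sum-cong-≗ {n} (λ b → cong χ (isLabel-complete id b refl)) ⟩
  ∑ {n} (λ _ → 1)        ≡⟨ ∑-const n 1 ⟩
  n * 1                  ≡⟨ ℕₚ.*-identityʳ n ⟩
  n                      ∎
  where open ≡-Reasoning

merge : ∀ {n} → Labelling n → Fin n → Fin n → Labelling n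
merge f a b x = if ⌊ f x ≟ b ⌋ then a else f x

merge-hit : ∀ {n} (f : Labelling n) a {b} x → f x ≡ b → merge f a b x ≡ a
merge-hit f a {b} x e rewrite ≟-complete {x = f x} {b} e = refl

merge-miss : ∀ {n} (f : Labelling n) a {b} x → f x ≢ b → merge f a b x ≡ f x
merge-miss f a {b} x e rewrite ≢-complete {x = f x} {b} e = refl

merge-step : ∀ {n} (f : Labelling n) u v → f u ≢ f v → MergeStep f (merge f (f u) (f v))
merge-step f u v ne = u , v , ne , λ x y → mk⇔ (to x y) (from x y)
  where
  g = merge f (f u) (f v)
  to : ∀ x y → g x ≡ g y → f x ≡ f y ⊎ (f x ≡ f u × f y ≡ f v) ⊎ (f x ≡ f v × f y ≡ f u)
  to x y e with f x ≟ f v | f y ≟ f v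
  ... | yes p | yes q = inj₁ (trans p (sym q))
  ... | yes p | no _  = inj₂ (inj₂ (p , sym e))
  ... | no _  | yes q = inj₂ (inj₁ (e , q))
  ... | no _  | no _  = inj₁ e
  from : ∀ x y → f x ≡ f y ⊎ (f x ≡ f u × f y ≡ f v) ⊎ (f x ≡ f v × f y ≡ f u) → g x ≡ g y
  from x y (inj₁ e) = cong (λ c → if ⌊ c ≟ f v ⌋ then f u else c) e
  from x y (inj₂ (inj₁ (p , q))) =
    trans (merge-miss f (f u) x (λ e → ne (trans (sym p) e))) (trans p (sym (merge-hit f (f u) y q)))
  from x y (inj₂ (inj₂ (p , q))) =
    trans (merge-hit f (f u) x p) (sym (trans (merge-miss f (f u) y (λ e → ne (trans (sym q) e))) q))

-- Only the label `f v` goes out of use; `f u` is kept by `u`, and every other label by the vertices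
-- that carry it.
parts-merge : ∀ {n} (f : Labelling n) u v → f u ≢ f v →
  parts f ≡ suc (parts (merge f (f u) (f v)))
parts-merge f u v ne = begin
  parts f                                          ≡⟨ countFin-∑ (isLabel f) ⟩
  ∑ (χ ∘ isLabel f)                                ≡⟨ sum-cong-≗ split ⟩
  ∑ (λ c → χ ⌊ c ≟ f v ⌋ + χ (isLabel g c))        ≡⟨ ∑-distrib-+ (λ c → χ ⌊ c ≟ f v ⌋) (χ ∘ isLabel g) ⟩
  ∑ (λ c → χ ⌊ c ≟ f v ⌋) + ∑ (χ ∘ isLabel g)      ≡⟨ cong₂ _+_ (∑-singleton (f v)) (sym (countFin-∑ (isLabel g))) ⟩
  suc (parts g)                                    ∎
  where
  open ≡-Reasoning
  g = merge f (f u) (f v)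

  f⇒g : ∀ c → c ≢ f v → isLabel f c ≡ true → isLabel g c ≡ true
  f⇒g c c≢ e with x , fx ← isLabel-sound f c e =
    isLabel-complete g x (trans (merge-miss f (f u) x (λ e → c≢ (trans (sym fx) e))) fx)

  g⇒f : ∀ c → isLabel g c ≡ true → isLabel f c ≡ true × c ≢ f v
  g⇒f c e with isLabel-sound g c e
  ... | x , gx with f x ≟ f v
  ...   | yes p = isLabel-complete f u gx , λ e → ne (trans gx e)
  ...   | no ¬p = isLabel-complete f x gx , λ e → ¬p (trans gx e)

  split : ∀ c → χ (isLabel f c) ≡ χ ⌊ c ≟ f v ⌋ + χ (isLabel g c)
  split c with c ≟ f v
  split c | yes refl = trans (cong χ (isLabel-complete f v refl))
    (cong suc (sym (χ-≢true (λ e → proj₂ (g⇒f c e) refl))))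
  split c | no c≢ = ℕₚ.≤-antisym (χ-mono (f⇒g c c≢)) (χ-mono (proj₁ ∘ g⇒f c))

-- If `a` is in use, then `a` and its red neighbours are distinct labels in use; if not, its red
-- degree is 0.
redDegree<parts : ∀ {n} (G : Graph n) f a → 0 < parts f → redDegree G f a < parts f
redDegree<parts {n} G f a pos with any? (λ x → f x ≟ a)
... | no none = subst (_< parts f) (sym (count-none (redEdge G f a)
      λ b e → none (RedEdge.u₁ (redEdge-sound G f a b e) , RedEdge.fu₁ (redEdge-sound G f a b e)))) pos
... | yes (x , fx) = begin
  suc (redDegree G f a)                                      ≡⟨ cong₂ _+_ (sym (∑-singleton a)) (countFin-∑ (redEdge G f a)) ⟩
  ∑ (λ b → χ ⌊ b ≟ a ⌋) + ∑ (χ ∘ redEdge G f a)              ≡⟨ ∑-distrib-+ (λ b → χ ⌊ b ≟ a ⌋) (χ ∘ redEdge G f a) ⟨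
  ∑ (λ b → χ ⌊ b ≟ a ⌋ + χ (redEdge G f a b))                ≤⟨ ∑-mono bound ⟩
  ∑ (χ ∘ isLabel f)                                          ≡⟨ countFin-∑ (isLabel f) ⟨
  parts f                                                    ∎
  where
  open ℕₚ.≤-Reasoning
  bound : ∀ b → χ ⌊ b ≟ a ⌋ + χ (redEdge G f a b) ≤ χ (isLabel f b)
  bound b with b ≟ a
  ... | yes refl = ℕₚ.≤-reflexive (trans
          (cong suc (χ-≢true (λ e → RedEdge.a≢b (redEdge-sound G f a b e) refl)))
          (cong χ (sym (isLabel-complete f x fx))))
  ... | no _ = χ-mono (λ e → let open RedEdge (redEdge-sound G f a b e) in isLabel-complete f w₁ fw₁)

parts-nonempty : ∀ {n} (f : Labelling (suc n)) → 0 < parts f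
parts-nonempty f = subst (0 <_) (sym (countFin-∑ (isLabel f)))
  (ℕₚ.≤-trans (ℕₚ.≤-reflexive (cong χ (sym (isLabel-complete f zero refl))))
    (∑-member (χ ∘ isLabel f) (f zero)))

parts-constant : ∀ {n} (f : Labelling (suc n)) → (∀ x → f x ≡ f zero) → parts f ≡ 1
parts-constant f h = trans (countFin-∑ (isLabel f))
  (trans (sum-cong-≗ eq) (∑-singleton (f zero)))
  where
  eq : ∀ b → χ (isLabel f b) ≡ χ ⌊ b ≟ f zero ⌋
  eq b = ℕₚ.≤-antisym
    (χ-mono (λ e → let x , fx = isLabel-sound f b e in ≟-complete (trans (sym fx) (h x))))
    (χ-mono (λ e → isLabel-complete f zero (sym (≟-sound e))))

-- A contraction sequence under construction, starting from the discrete partition. The number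
-- counts the merges made so far, and the labelling is the current one.
data Chain {n} (G : Graph (suc n)) (d : ℕ) : ℕ → Labelling (suc n) → Set where
  start : ∀ {f} → Discrete f → maxRedDegree G f ≤ d → Chain G d 0 f
  _▷_∣_ : ∀ {m f g} → Chain G d m f → MergeStep f g → maxRedDegree G g ≤ d → Chain G d (suc m) g

module _ {n} {G : Graph (suc n)} {d : ℕ} where

  -- Index `zero` is the latest labelling, since `ContractionSequence` numbers its partitions from
  -- the coarsest upwards.
  partAt : ∀ {m f} → Chain G d m f → Fin (suc m) → Labelling (suc n)
  partAt {f = f} (start _ _)   _       = f
  partAt {f = f} (c ▷ _ ∣ _)   zero    = f
  partAt         (c ▷ _ ∣ _)   (suc i) = partAt c i

  partAt-zero : ∀ {m f} (c : Chain G d m f) → partAt c zero ≡ f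
  partAt-zero (start _ _) = refl
  partAt-zero (c ▷ _ ∣ _) = refl

  partAt-discrete : ∀ {m f} (c : Chain G d m f) → Discrete (partAt c (fromℕ m))
  partAt-discrete (start disc _) = disc
  partAt-discrete (c ▷ _ ∣ _)    = partAt-discrete c

  partAt-steps : ∀ {m f} (c : Chain G d m f) (i : Fin m) →
    MergeStep (partAt c (suc i)) (partAt c (inject₁ i))
  partAt-steps (_▷_∣_ {g = g} c s _) zero = subst (λ h → MergeStep h g) (sym (partAt-zero c)) s
  partAt-steps (c ▷ _ ∣ _) (suc i)        = partAt-steps c i

  partAt-width : ∀ {m f} (c : Chain G d m f) i → maxRedDegree G (partAt c i) ≤ d
  partAt-width (start _ w) i       = w
  partAt-width (c ▷ _ ∣ w) zero    = w
  partAt-width (c ▷ _ ∣ w) (suc i) = partAt-width c i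

  fromChain : ∀ {f} → Chain G d n f → Σ (ContractionSequence n) λ S → width≤ G S d
  fromChain c = record
    { part     = partAt c
    ; discrete = partAt-discrete c
    ; steps    = partAt-steps c
    } , partAt-width c

  -- With at most d + 1 parts left, no red degree can exceed d.
  finish : ∀ k {m} f → parts f ≡ suc k → k ≤ d → m + k ≡ n → Chain G d m f →
    Σ (ContractionSequence n) λ S → width≤ G S d
  finish zero {m} f pf k≤d eq c =
    fromChain (subst (λ m → Chain G d m f) (trans (sym (ℕₚ.+-identityʳ m)) eq) c)
  finish (suc k) {m} f pf k≤d eq c with any? (λ x → ¬? (f zero ≟ f x))
  ... | no none = contradiction (trans (sym pf) (parts-constant f const)) λ ()
    where
    const : ∀ x → f x ≡ f zero
    const x = decidable-stable (f x ≟ f zero) (λ ne → none (x , λ e → ne (sym e)))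
  ... | yes (v , ne) = finish k g pg (ℕₚ.<⇒≤ k≤d) (trans (sym (ℕₚ.+-suc m k)) eq)
          (c ▷ merge-step f zero v ne ∣ maxFin-least _ width)
    where
    g = merge f (f zero) (f v)
    pg : parts g ≡ suc k
    pg = ℕₚ.suc-injective (trans (sym (parts-merge f zero v ne)) pf)
    width : ∀ a → redDegree G g a ≤ d
    width a = ℕₚ.≤-trans (ℕₚ.≤-pred (subst (redDegree G g a <_) pg (redDegree<parts G g a (parts-nonempty g))))
                (ℕₚ.<⇒≤ k≤d)

-- Contracting one pair

distinguishes : ∀ {n} → Graph n → Fin n → Fin n → Fin n → Bool
distinguishes G u v w = not ⌊ w ≟ u ⌋ ∧ not ⌊ w ≟ v ⌋ ∧ (adj G u w xor adj G v w)

xor-sound : ∀ {x y} → x xor y ≡ true → x ≢ y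
xor-sound {true} () refl
xor-sound {false} () refl

xor-complete : ∀ {x y} → x ≢ y → x xor y ≡ true
xor-complete {true}  {true}  ne = contradiction refl ne
xor-complete {true}  {false} ne = refl
xor-complete {false} {true}  ne = refl
xor-complete {false} {false} ne = contradiction refl ne

distinguishes-sound : ∀ {n} (G : Graph n) {u v} w → distinguishes G u v w ≡ true →
  w ≢ u × w ≢ v × adj G u w ≢ adj G v w
distinguishes-sound G w e
  with e₁ , e ← ∧-split e
  with e₂ , e₃ ← ∧-split e = ≢-sound e₁ , ≢-sound e₂ , xor-sound e₃

distinguishes-complete : ∀ {n} (G : Graph n) {u v} w →
  w ≢ u → w ≢ v → adj G u w ≢ adj G v w → distinguishes G u v w ≡ true
distinguishes-complete G w e₁ e₂ e₃ = ∧-join (≢-not e₁) (∧-join (≢-not e₂) (xor-complete e₃))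

discrepancy : ∀ {n} → Graph n → Fin n → Fin n → ℕ
discrepancy G u v = countFin (distinguishes G u v)

-- The fibres are those of `mergePair u v`, but the labels are arbitrary, because a `MergeStep` may
-- rename every part.
MergesOnly : ∀ {n} → Labelling n → Fin n → Fin n → Set
MergesOnly g u v = g u ≡ g v ×
  (∀ x y → g x ≡ g y → x ≡ y ⊎ (x ≡ u × y ≡ v) ⊎ (x ≡ v × y ≡ u))

-- Each distinguisher is a part by itself and has an edge to one of `u` and `v` and a non-edge to
-- the other.
discrepancy≤redDegree : ∀ {n} (G : Graph n) (g : Labelling n) u v → MergesOnly g u v →
  discrepancy G u v ≤ redDegree G g (g u)
discrepancy≤redDegree G g u v (gu≡gv , only) =
  count-inj _ _ (λ w b → g w ≡ b × w ≢ u × w ≢ v)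
    (λ w e → let w≢u , w≢v , ne = distinguishes-sound G w e in
      g w , redEdge-complete G g (g u) (g w) (red w w≢u w≢v ne) , refl , w≢u , w≢v)
    same
  where
  same : ∀ {w w′ b} → g w ≡ b × w ≢ u × w ≢ v → g w′ ≡ b × w′ ≢ u × w′ ≢ v → w ≡ w′
  same {w} {w′} (e , w≢u , w≢v) (e′ , _) with only w w′ (trans e (sym e′))
  ... | inj₁ p              = p
  ... | inj₂ (inj₁ (p , _)) = contradiction p w≢u
  ... | inj₂ (inj₂ (p , _)) = contradiction p w≢v

  apart : ∀ w → w ≢ u → w ≢ v → g u ≢ g w
  apart w w≢u w≢v e with only u w e
  ... | inj₁ p              = w≢u (sym p)
  ... | inj₂ (inj₁ (_ , p)) = w≢v p
  ... | inj₂ (inj₂ (_ , p)) = w≢u p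

  red : ∀ w → w ≢ u → w ≢ v → adj G u w ≢ adj G v w → RedEdge G g (g u) (g w)
  red w w≢u w≢v ne with adj G u w in eu | adj G v w in ev
  ... | true  | true  = contradiction refl ne
  ... | false | false = contradiction refl ne
  ... | true  | false = redEdge-witness (apart w w≢u w≢v) u w refl refl eu v w (sym gu≡gv) refl ev
  ... | false | true  = redEdge-witness (apart w w≢u w≢v) v w (sym gu≡gv) refl ev u w refl refl eu

mergePair-only : ∀ {n} (u v : Fin n) → u ≢ v → MergesOnly (mergePair u v) u v
mergePair-only u v u≢v =
  Equivalence.from (iff u v) (inj₂ (inj₁ (refl , refl))) , λ x y → Equivalence.to (iff x y)
  where
  -- `mergePair u v` is `merge id u v` by definition.
  iff = proj₂ (proj₂ (proj₂ (merge-step id u v u≢v)))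

mergePair-fibre : ∀ {n} (u v : Fin n) x {b} → mergePair u v x ≡ b →
  (x ≡ b × x ≢ v) ⊎ (x ≡ v × u ≡ b)
mergePair-fibre u v x e with x ≟ v
... | yes p = inj₂ (p , e)
... | no ¬p = inj₁ (e , ¬p)

-- Red neighbours of the merged part are distinguishers. Any other label can be red only to `u`, and
-- only when it is itself a distinguisher, so that the discrepancy is at least 1.
redDegree-mergePair : ∀ {n} (G : Graph n) u v a →
  redDegree G (mergePair u v) a ≤ discrepancy G u v
redDegree-mergePair G u v a with a ≟ u
... | yes refl = count-inj _ _ _≡_ (λ b e → b , dist b (redEdge-sound G _ u b e) , refl)
                   (λ p q → trans p (sym q))
  where
  f = mergePair u v
  dist : ∀ b → RedEdge G f u b → distinguishes G u v b ≡ true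
  dist b (redEdge-witness u≢b u₁ w₁ fu₁ fw₁ e₁ u₀ w₀ fu₀ fw₀ e₀)
    with mergePair-fibre u v w₁ fw₁ | mergePair-fibre u v w₀ fw₀
  ... | inj₂ (_ , p) | _ = contradiction p u≢b
  ... | inj₁ _ | inj₂ (_ , p) = contradiction p u≢b
  ... | inj₁ (refl , b≢v) | inj₁ (refl , _)
    with mergePair-fibre u v u₁ fu₁ | mergePair-fibre u v u₀ fu₀
  ... | inj₁ (refl , _) | inj₁ (refl , _) = clash e₁ e₀
  ... | inj₂ (refl , _) | inj₂ (refl , _) = clash e₁ e₀
  ... | inj₁ (refl , _) | inj₂ (refl , _) = distinguishes-complete G b (≢-sym u≢b) b≢v
          (λ e → clash e₁ (trans e e₀))
  ... | inj₂ (refl , _) | inj₁ (refl , _) = distinguishes-complete G b (≢-sym u≢b) b≢v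
          (λ e → clash e₁ (trans (sym e) e₀))
... | no a≢u = count-inj _ _ (λ b _ → b ≡ u) (λ b e → a , dist b (redEdge-sound G _ a b e))
                   (λ p q → trans p (sym q))
  where
  f = mergePair u v
  dist : ∀ b → RedEdge G f a b → distinguishes G u v a ≡ true × b ≡ u
  dist b (redEdge-witness a≢b u₁ w₁ fu₁ fw₁ e₁ u₀ w₀ fu₀ fw₀ e₀)
    with mergePair-fibre u v u₁ fu₁ | mergePair-fibre u v u₀ fu₀
  ... | inj₂ (_ , p) | _ = contradiction (sym p) a≢u
  ... | inj₁ _ | inj₂ (_ , p) = contradiction (sym p) a≢u
  ... | inj₁ (refl , a≢v) | inj₁ (refl , _)
    with mergePair-fibre u v w₁ fw₁ | mergePair-fibre u v w₀ fw₀
  ... | inj₁ (refl , _) | inj₁ (refl , _) = clash e₁ e₀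
  ... | inj₂ (refl , _) | inj₂ (refl , _) = clash e₁ e₀
  ... | inj₁ (refl , _) | inj₂ (refl , refl) =
          distinguishes-complete G a a≢u a≢v
            (λ e → clash e₁ (trans (adj-sym G a b) (trans e (trans (adj-sym G v a) e₀)))) , refl
  ... | inj₂ (refl , refl) | inj₁ (refl , _) =
          distinguishes-complete G a a≢u a≢v
            (λ e → clash e₁ (trans (adj-sym G a v) (trans (sym e) (trans (adj-sym G b a) e₀)))) , refl

maxRedDegree-mergePair : ∀ {n} (G : Graph n) u v → u ≢ v →
  maxRedDegree G (mergePair u v) ≡ discrepancy G u v
maxRedDegree-mergePair G u v u≢v = ℕₚ.≤-antisym
  (maxFin-least _ (redDegree-mergePair G u v))
  (ℕₚ.≤-trans (discrepancy≤redDegree G (mergePair u v) u v (mergePair-only u v u≢v))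
    (maxFin-upper (redDegree G (mergePair u v)) (mergePair u v u)))

-- The first contraction already costs the discrepancy of the merged pair.
width-lower : ∀ {n} (G : Graph (suc (suc n))) {c} → (∀ u v → u ≢ v → c ≤ discrepancy G u v) →
  ∀ (S : ContractionSequence (suc n)) d → width≤ G S d → c ≤ d
width-lower {n} G {c} h S d w with steps S (fromℕ n)
... | u , v , ne , iff = begin
  c                             ≤⟨ h u v (λ e → ne (cong f e)) ⟩
  discrepancy G u v             ≤⟨ discrepancy≤redDegree G g u v only ⟩
  redDegree G g (g u)           ≤⟨ maxFin-upper (redDegree G g) (g u) ⟩
  maxRedDegree G g              ≤⟨ w (inject₁ (fromℕ n)) ⟩
  d                             ∎
  where
  open ℕₚ.≤-Reasoning
  -- `suc (fromℕ n)` is the index of the discrete partition, so `g` results from the first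
  -- contraction.
  f = part S (suc (fromℕ n))
  g = part S (inject₁ (fromℕ n))
  only : MergesOnly g u v
  only = Equivalence.from (iff u v) (inj₂ (inj₁ (refl , refl))) , λ x y e → inject (Equivalence.to (iff x y) e)
    where
    inject : ∀ {x y} → f x ≡ f y ⊎ (f x ≡ f u × f y ≡ f v) ⊎ (f x ≡ f v × f y ≡ f u) →
      x ≡ y ⊎ (x ≡ u × y ≡ v) ⊎ (x ≡ v × y ≡ u)
    inject (inj₁ p)              = inj₁ (discrete S _ _ p)
    inject (inj₂ (inj₁ (p , q))) = inj₂ (inj₁ (discrete S _ _ p , discrete S _ _ q))
    inject (inj₂ (inj₂ (p , q))) = inj₂ (inj₂ (discrete S _ _ p , discrete S _ _ q))

-- Contracting a pairing

-- For each level, `lower` and `level` record what follows from an automorphism that swaps mates on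
-- this level and fixes all lower levels. A vertex that is its own mate is unmatched.
record Pairing {n} (G : Graph n) : Set where
  field
    mate          : Fin n → Fin n
    lev           : Fin n → ℕ
    mate-invol    : ∀ x → mate (mate x) ≡ x
    lev-mate      : ∀ x → lev (mate x) ≡ lev x
    lower         : ∀ x y → lev y < lev x → adj G y x ≡ adj G y (mate x)
    level         : ∀ x y → lev y ≡ lev x → adj G y x ≡ adj G (mate y) (mate x)
    fixed-unique  : ∀ x y → mate x ≡ x → mate y ≡ y → x ≡ y
    fixed-level-0 : ∀ x → mate x ≡ x → lev x ≡ 0

half-≤ : ∀ {c r} → c + c ≤ suc (r + r) → c ≤ r
half-≤ {c} {r} h with c ℕₚ.≤? r
... | yes p = p
... | no ¬p = contradiction h (ℕₚ.<⇒≱ (begin-strict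
  suc (r + r)    <⟨ ℕₚ.n<1+n _ ⟩
  suc (suc (r + r)) ≡⟨ cong suc (ℕₚ.+-suc r r) ⟨
  suc r + suc r  ≤⟨ ℕₚ.+-mono-≤ (ℕₚ.≰⇒> ¬p) (ℕₚ.≰⇒> ¬p) ⟩
  c + c          ∎))
  where open ℕₚ.≤-Reasoning

maximal : ∀ {n} {P : Fin n → Set} → (∀ x → Dec (P x)) → (l : Fin n → ℕ) → ∃ P →
  ∃[ x ] (P x × ∀ y → P y → l y ≤ l x)
maximal {P = P} P? l (x , px) = go (maxFin l) x px (ℕₚ.m≤n+m _ (l x))
  where
  -- The fuel `k` bounds the gap between `l x` and the largest value of `l`; every better candidate
  -- shrinks it.
  go : ∀ k x → P x → maxFin l ≤ l x + k → ∃[ x ] (P x × ∀ y → P y → l y ≤ l x)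
  go k x px bound with any? (λ y → P? y ×-dec (l x ℕₚ.<? l y))
  ... | no none = x , px , λ y py → ℕₚ.≮⇒≥ (λ lt → none (y , py , lt))
  go zero x px bound | yes (y , py , lt) = contradiction
    (ℕₚ.≤-trans (maxFin-upper l y) (subst (maxFin l ≤_) (ℕₚ.+-identityʳ _) bound)) (ℕₚ.<⇒≱ lt)
  go (suc k) x px bound | yes (y , py , lt) = go k y py
    (ℕₚ.≤-trans bound (ℕₚ.≤-trans (ℕₚ.≤-reflexive (ℕₚ.+-suc (l x) k)) (ℕₚ.+-monoˡ-≤ k lt)))

module Contract {n} (G : Graph (suc n)) (P : Pairing G) (r : ℕ) (n≡r+r : n ≡ r + r)
  (D : ∀ u v → u ≢ v → discrepancy G u v ≡ r) where

  open Pairing P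

  mate-flip : ∀ {x y} → y ≡ mate x → mate y ≡ x
  mate-flip {x} e = trans (cong mate e) (mate-invol x)

  -- The labellings met while the pairs {x , mate x} are merged, higher levels first.
  record Descent (f : Labelling (suc n)) : Set where
    field
      -- Labels are taken from the pair that they name, so that sets of labels can be compared with
      -- their images under `mate`.
      near       : ∀ x → f x ≡ x ⊎ f x ≡ mate x
      fibre      : ∀ x y → f x ≡ f y → y ≡ x ⊎ y ≡ mate x
      descending : ∀ x y → mate x ≢ x → f x ≡ f (mate x) → lev x < lev y → f y ≡ f (mate y)

  -- Such a set and its image under `mate` are disjoint and lie among `2 r + 1` vertices. The
  -- hypothesis also keeps the unmatched vertex out.
  count-half : (p : Fin (suc n) → Bool) → (∀ b → p b ≡ true → p (mate b) ≡ true → ⊥) →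
    countFin p ≤ r
  count-half p disj = half-≤ (begin
    countFin p + countFin p           ≤⟨ ℕₚ.+-monoʳ-≤ (countFin p) flip ⟩
    countFin p + countFin (p ∘ mate)  ≤⟨ count-disjoint p (p ∘ mate) disj ⟩
    suc n                             ≡⟨ cong suc n≡r+r ⟩
    suc (r + r)                       ∎)
    where
    open ℕₚ.≤-Reasoning
    flip : countFin p ≤ countFin (p ∘ mate)
    flip = count-inj p (p ∘ mate) (λ b u → b ≡ mate u)
      (λ b pb → mate b , trans (cong p (mate-invol b)) pb , sym (mate-invol b))
      (λ e e′ → trans e (sym e′))

  module Width (f : Labelling (suc n)) (I : Descent f) where
    open Descent I

    twoMembers : ∀ {w w′ b} → f w ≡ b → f w′ ≡ b → w ≢ w′ →
      w′ ≡ mate w × mate w ≢ w × f w ≡ f (mate w)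
    twoMembers {w} {w′} p q ne with fibre w w′ (trans p (sym q))
    ... | inj₁ e    = contradiction (sym e) ne
    ... | inj₂ refl = refl , (λ e → ne (sym e)) , trans p (sym q)

    -- By `near`, the label of a merged pair is one of its two vertices. Hence `b` and `mate b`
    -- cannot both label merged pairs, which is what `count-half` asks for.
    merged-label : ∀ b → isLabel f b ≡ true → (∀ w → f w ≡ b → f w ≡ f (mate w)) →
      f b ≡ b × f (mate b) ≡ b
    merged-label b lb h with isLabel-sound f b lb
    ... | w , refl with near w
    ...   | inj₁ e = cong f e , trans (cong (f ∘ mate) e) (sym (h w refl))
    ...   | inj₂ e = trans (cong f e) (sym (h w refl)) , cong f (mate-flip e)

    -- A single vertex is red only to a merged pair that it splits, and by `lower` it splits no pair
    -- of a higher level.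
    singleton-red : ∀ {x b} → (∀ z → f z ≡ f x → z ≡ x) → RedEdge G f (f x) b →
      ∃[ w ] (f w ≡ b × mate w ≢ w × f w ≡ f (mate w) × lev w ≤ lev x × adj G x w ≢ adj G x (mate w))
    singleton-red {x} single (redEdge-witness _ u₁ w₁ fu₁ fw₁ e₁ u₀ w₀ fu₀ fw₀ e₀)
      with refl ← single u₁ fu₁ | refl ← single u₀ fu₀
      with refl , mw≢w , fw ← twoMembers fw₁ fw₀ (λ e → clash e₁ (trans (cong (adj G x) e) e₀))
      = w₁ , fw₁ , mw≢w , fw , ℕₚ.≮⇒≥ (λ lt → ne (lower w₁ x lt)) , ne
      where
      ne : adj G x w₁ ≢ adj G x (mate w₁)
      ne e = clash e₁ (trans e e₀)

    -- As `x` is unmerged, `descending` rules out merged pairs of lower level, so each red neighbour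
    -- is a pair `{w , mate w}` on the level of `x`. By `level`, if `x` splits this pair, then `w`
    -- distinguishes `x` from `mate x`.
    width-single : ∀ x → f x ≢ f (mate x) → redDegree G f (f x) ≤ r
    width-single x fx≢ = ℕₚ.≤-trans
      (count-inj _ _ (λ b w → f w ≡ b)
        (λ b e → distinct b (redEdge-sound G f (f x) b e)) (λ p q → trans (sym p) q))
      (ℕₚ.≤-reflexive (D x (mate x) (λ e → fx≢ (cong f e))))
      where
      single : ∀ z → f z ≡ f x → z ≡ x
      single z e with fibre x z (sym e)
      ... | inj₁ p    = p
      ... | inj₂ refl = contradiction (sym e) fx≢

      distinct : ∀ b → RedEdge G f (f x) b → ∃[ w ] (distinguishes G x (mate x) w ≡ true × f w ≡ b)
      distinct b R with singleton-red single R
      ... | w , refl , mw≢w , fw , le , ne with ℕₚ.m≤n⇒m<n∨m≡n le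
      ...   | inj₁ lt = contradiction (descending w x mw≢w fw lt) fx≢
      ...   | inj₂ eq = w , distinguishes-complete G w
                (λ e → RedEdge.a≢b R (cong f (sym e)))
                (λ e → RedEdge.a≢b R (trans (cong f (sym (mate-flip e))) (sym fw)))
                (λ e → ne (trans e (trans (cong (adj G (mate x)) (sym (mate-invol w)))
                  (sym (level (mate w) x (trans (sym eq) (sym (lev-mate w)))))))) , refl

    -- A pair split by `x` would have level 0 like `x`, but `level` with `mate x ≡ x` says that `x`
    -- treats both of its vertices alike.
    width-fixed : ∀ x → mate x ≡ x → redDegree G f (f x) ≤ r
    width-fixed x mx = subst (_≤ r) (sym (count-none _ λ b e → none b (redEdge-sound G f (f x) b e))) z≤n
      where
      single : ∀ z → f z ≡ f x → z ≡ x
      single z e with fibre x z (sym e)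
      ... | inj₁ p = p
      ... | inj₂ p = trans p mx

      none : ∀ b → ¬ RedEdge G f (f x) b
      none b R with w , _ , _ , _ , le , ne ← singleton-red single R = ne
        (trans (level w x (trans (fixed-level-0 x mx) (sym (ℕₚ.n≤0⇒n≡0 (subst (lev w ≤_) (fixed-level-0 x mx) le)))))
          (cong (λ y → adj G y (mate w)) mx))

    module Pair (x : Fin (suc n)) (mx≢x : mate x ≢ x) (fx : f x ≡ f (mate x)) where

      members : ∀ {u} (w : Fin (suc n)) → f u ≡ f x → adj G x w ≡ adj G (mate x) w → adj G u w ≡ adj G x w
      members {u} w e same with fibre x u (sym e)
      ... | inj₁ refl = refl
      ... | inj₂ refl = sym same

      red-dist : ∀ {b} w → f w ≡ b → f x ≢ b → adj G x w ≢ adj G (mate x) w →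
        distinguishes G x (mate x) w ≡ true
      red-dist w fw x∉ ne = distinguishes-complete G w
        (λ e → x∉ (trans (cong f (sym e)) fw))
        (λ e → x∉ (trans fx (trans (cong f (sym e)) fw))) ne

      -- Each red neighbour contains a distinguisher. Otherwise `x` and `mate x` agree on both `w₁`
      -- and `w₀`, so these form a merged pair split by `x`; its level is not lower, and `lower` or
      -- `level` gives a contradiction.
      width-lowest : (∀ y → mate y ≢ y → f y ≡ f (mate y) → lev x ≤ lev y) → redDegree G f (f x) ≤ r
      width-lowest lowest = ℕₚ.≤-trans
        (count-inj _ _ (λ b w → f w ≡ b)
          (λ b e → distinct b (redEdge-sound G f (f x) b e)) (λ p q → trans (sym p) q))
        (ℕₚ.≤-reflexive (D x (mate x) (≢-sym mx≢x)))
        where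
        distinct : ∀ b → RedEdge G f (f x) b → ∃[ w ] (distinguishes G x (mate x) w ≡ true × f w ≡ b)
        distinct b (redEdge-witness a≢b u₁ w₁ fu₁ fw₁ e₁ u₀ w₀ fu₀ fw₀ e₀)
          with adj G x w₁ ≟ᵇ adj G (mate x) w₁ | adj G x w₀ ≟ᵇ adj G (mate x) w₀
        ... | no ne | _ = w₁ , red-dist w₁ fw₁ a≢b ne , fw₁
        ... | yes _ | no ne = w₀ , red-dist w₀ fw₀ a≢b ne , fw₀
        ... | yes s₁ | yes s₀ = ⊥-elim absurd
          where
          x₁ : adj G x w₁ ≡ true
          x₁ = trans (sym (members w₁ fu₁ s₁)) e₁
          x₀ : adj G x w₀ ≡ false
          x₀ = trans (sym (members w₀ fu₀ s₀)) e₀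
          absurd : ⊥
          absurd with refl , mw≢w , fw ← twoMembers fw₁ fw₀ (λ e → clash x₁ (trans (cong (adj G x) e) x₀))
            with ℕₚ.m≤n⇒m<n∨m≡n (lowest w₁ mw≢w fw)
          ... | inj₁ lt = clash x₁ (trans (lower w₁ x lt) x₀)
          ... | inj₂ eq = clash x₁ (trans (level w₁ x eq) (trans (sym s₀) x₀))

      -- A single vertex below the level of `x` is not red to the pair, by `lower`; a vertex at or
      -- above that level lies above `y` and is therefore merged. So all red neighbours are merged
      -- pairs, and `count-half` applies.
      width-higher : ∀ y → mate y ≢ y → f y ≡ f (mate y) → lev y < lev x → redDegree G f (f x) ≤ r
      width-higher y my≢y fy y<x = count-half (redEdge G f (f x)) disj
        where
        partner-merged : ∀ {b} → RedEdge G f (f x) b → ∀ w → f w ≡ b → mate w ≢ w × f w ≡ f (mate w)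
        partner-merged (redEdge-witness a≢b u₁ w₁ fu₁ fw₁ e₁ u₀ w₀ fu₀ fw₀ e₀) w fw
          with w ≟ w₁ | w ≟ w₀
        ... | no ne | _ = proj₂ (twoMembers fw fw₁ ne)
        ... | yes _ | no ne = proj₂ (twoMembers fw fw₀ ne)
        ... | yes refl | yes refl = mw≢w , descending y w my≢y fy (ℕₚ.<-≤-trans y<x x≤w)
          where
          x≤w : lev x ≤ lev w
          x≤w = ℕₚ.≮⇒≥ λ lt →
            let same = trans (adj-sym G x w) (trans (lower x w lt) (adj-sym G w (mate x))) in
            clash e₁ (trans (members w fu₁ same) (trans (sym (members w fu₀ same)) e₀))
          mw≢w : mate w ≢ w
          mw≢w e = ℕₚ.n≮0 (subst (lev y <_) (fixed-level-0 w e) (ℕₚ.<-≤-trans y<x x≤w))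

        own-label : ∀ b → redEdge G f (f x) b ≡ true → f b ≡ b × f (mate b) ≡ b × mate b ≢ b
        own-label b e =
          let R        = redEdge-sound G f (f x) b e
              fb , fmb = merged-label b (isLabel-complete f (RedEdge.w₁ R) (RedEdge.fw₁ R))
                           (λ w fw → proj₂ (partner-merged R w fw))
          in fb , fmb , proj₁ (partner-merged R b fb)

        disj : ∀ b → redEdge G f (f x) b ≡ true → redEdge G f (f x) (mate b) ≡ true → ⊥
        disj b e e′ =
          let _ , fmb , mb≢b = own-label b e
              fmb′ , _       = own-label (mate b) e′
          in mb≢b (trans (sym fmb′) fmb)

    redDegree-≤ : ∀ x → redDegree G f (f x) ≤ r
    redDegree-≤ x with f x ≟ f (mate x) | mate x ≟ x
    ... | no fx≢ | _      = width-single x fx≢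
    ... | yes _  | yes mx = width-fixed x mx
    ... | yes fx | no mx≢
      with any? (λ y → ¬? (mate y ≟ y) ×-dec (f y ≟ f (mate y) ×-dec lev y ℕₚ.<? lev x))
    ...   | yes (y , my≢y , fy , lt) = Pair.width-higher x mx≢ fx y my≢y fy lt
    ...   | no none = Pair.width-lowest x mx≢ fx (λ y my≢y fy → ℕₚ.≮⇒≥ (λ lt → none (y , my≢y , fy , lt)))

    width-≤ : maxRedDegree G f ≤ r
    width-≤ = maxFin-least _ λ a → count-≤-if-inhabited (redEdge G f a) λ b e →
      let open RedEdge (redEdge-sound G f a b e) in
      subst (λ a → redDegree G f a ≤ r) fu₁ (redDegree-≤ u₁)

    -- There is at most one unmatched vertex, and the labels of merged pairs are counted by
    -- `count-half`.
    merged-parts : (∀ x → f x ≡ f (mate x)) → parts f ≤ suc r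
    merged-parts merged = begin
      parts f                                  ≡⟨ countFin-∑ (isLabel f) ⟩
      ∑ (χ ∘ isLabel f)                        ≤⟨ ∑-mono split ⟩
      ∑ (λ b → χ (fix b) + χ (p b))            ≡⟨ ∑-distrib-+ (χ ∘ fix) (χ ∘ p) ⟩
      ∑ (χ ∘ fix) + ∑ (χ ∘ p)                  ≤⟨ ℕₚ.+-mono-≤
        (∑-atMostOne fix (λ x y ex ey → fixed-unique x y (≟-sound ex) (≟-sound ey)))
        (ℕₚ.≤-reflexive (sym (countFin-∑ p))) ⟩
      suc (countFin p)                         ≤⟨ s≤s (count-half p disj) ⟩
      suc r                                    ∎
      where
      open ℕₚ.≤-Reasoning
      fix p : Fin (suc n) → Bool
      fix b = ⌊ mate b ≟ b ⌋
      p b = not (fix b) ∧ isLabel f b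

      split : ∀ b → χ (isLabel f b) ≤ χ (fix b) + χ (p b)
      split b with fix b
      ... | false = ℕₚ.≤-refl
      ... | true with isLabel f b
      ...   | true  = s≤s z≤n
      ...   | false = z≤n

      disj : ∀ b → p b ≡ true → p (mate b) ≡ true → ⊥
      disj b e e′ =
        let mb≢b , lb = ∧-split e
            _ , lmb   = ∧-split e′
        in ≢-sound mb≢b (trans (sym (proj₁ (merged-label (mate b) lmb (λ w _ → merged w))))
                               (proj₂ (merged-label b lb (λ w _ → merged w))))

  descent-id : Descent id
  descent-id = record
    { near       = λ x → inj₁ refl
    ; fibre      = λ x y e → inj₁ (sym e)
    ; descending = λ x y mx≢x e _ → contradiction (sym e) mx≢x
    }

  -- Choosing an unmerged pair of greatest level keeps `descending`: nothing above the new pair is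
  -- left unmerged.
  descent-merge : ∀ f → Descent f → ∀ x → f x ≢ f (mate x) →
    (∀ y → f y ≢ f (mate y) → lev y ≤ lev x) → Descent (merge f (f x) (f (mate x)))
  descent-merge f I x fx≢ top = record { near = near′ ; fibre = fibre′ ; descending = descending′ }
    where
    open Descent I
    g = merge f (f x) (f (mate x))

    g-cong : ∀ {y z} → f y ≡ f z → g y ≡ g z
    g-cong = cong (λ c → if ⌊ c ≟ f (mate x) ⌋ then f x else c)

    only-mate : ∀ {y} → f y ≡ f (mate x) → y ≡ mate x
    only-mate {y} e with fibre (mate x) y (sym e)
    ... | inj₁ p = p
    ... | inj₂ p = contradiction (trans (cong f (sym (trans p (mate-invol x)))) e) fx≢

    near′ : ∀ y → g y ≡ y ⊎ g y ≡ mate y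
    near′ y with f y ≟ f (mate x)
    ... | no _ = near y
    ... | yes e with refl ← only-mate e with near x
    ...   | inj₁ p = inj₂ (trans p (sym (mate-invol x)))
    ...   | inj₂ p = inj₁ p

    fibre′ : ∀ y z → g y ≡ g z → z ≡ y ⊎ z ≡ mate y
    fibre′ y z e with f y ≟ f (mate x) | f z ≟ f (mate x)
    ... | yes p | yes q = inj₁ (trans (only-mate q) (sym (only-mate p)))
    ... | no _  | no _  = fibre y z e
    ... | yes p | no _ with refl ← only-mate p with fibre x z e
    ...   | inj₁ q = inj₂ (trans q (sym (mate-invol x)))
    ...   | inj₂ q = inj₁ q
    fibre′ y z e | no _ | yes q with refl ← only-mate q with fibre x y (sym e)
    ...   | inj₁ refl = inj₂ refl
    ...   | inj₂ p = inj₁ (sym p)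

    lev-top : ∀ y → f y ≢ f (mate y) → g y ≡ g (mate y) → lev y ≡ lev x
    lev-top y ne e with f y ≟ f (mate x) | f (mate y) ≟ f (mate x)
    ... | yes p | _     = trans (cong lev (only-mate p)) (lev-mate x)
    ... | no _  | yes q = cong lev (trans (sym (mate-invol y)) (mate-flip (only-mate q)))
    ... | no _  | no _  = contradiction e ne

    descending′ : ∀ y z → mate y ≢ y → g y ≡ g (mate y) → lev y < lev z → g z ≡ g (mate z)
    descending′ y z my≢y e lt with f z ≟ f (mate z)
    ... | yes p = g-cong p
    ... | no ¬p with f y ≟ f (mate y)
    ...   | yes q = contradiction (descending y z my≢y q lt) ¬p
    ...   | no ¬q = contradiction (top z ¬p) (ℕₚ.<⇒≱ (subst (_< lev z) (lev-top y ¬q e) lt))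

  -- Here `m` counts the merges made and `k` those still to come. Once every pair is merged, at most
  -- `r + 1` parts remain and `finish` takes over.
  run : ∀ k {m} f → Descent f → parts f ≡ suc k → m + k ≡ n → Chain G r m f →
    Σ (ContractionSequence n) λ S → width≤ G S r
  run k f I pf eq c with any? (λ x → ¬? (f x ≟ f (mate x)))
  ... | no none = finish k f pf (ℕₚ.≤-pred (subst (_≤ suc r) pf (Width.merged-parts f I merged))) eq c
    where
    merged : ∀ x → f x ≡ f (mate x)
    merged x = decidable-stable (f x ≟ f (mate x)) (λ ne → none (x , ne))
  ... | yes some with maximal (λ x → ¬? (f x ≟ f (mate x))) lev some
  run zero f I pf eq c | yes some | x , ne , top =
    contradiction (ℕₚ.suc-injective (trans (sym pf) (parts-merge f x (mate x) ne)))
      (ℕₚ.<⇒≢ (parts-nonempty (merge f (f x) (f (mate x)))))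
  run (suc k) {m} f I pf eq c | yes some | x , ne , top =
    run k g I′ (ℕₚ.suc-injective (trans (sym (parts-merge f x (mate x) ne)) pf))
      (trans (sym (ℕₚ.+-suc m k)) eq)
      (c ▷ merge-step f x (mate x) ne ∣ Width.width-≤ g I′)
    where
    g = merge f (f x) (f (mate x))
    I′ = descent-merge f I x ne top

  contraction : Σ (ContractionSequence n) λ S → width≤ G S r
  contraction = run n id descent-id (parts-id (suc n)) refl (start (λ x y e → e) (Width.width-≤ id descent-id))

-- Antipodes on the cycles of a complementing permutation

fold-*-pointwise : ∀ {A : Set} (g : A → A) x m k → fold x g (m * k) ≡ fold x (λ y → fold y g k) m
fold-*-pointwise g x zero    k = refl
fold-*-pointwise g x (suc m) k = trans (fold-+ x g k) (cong (λ y → fold y g k) (fold-*-pointwise g x m k))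

fold-fixed : ∀ {A : Set} (g : A → A) {x} k → g x ≡ x → fold x g k ≡ x
fold-fixed g zero    e = refl
fold-fixed g (suc k) e = trans (cong g (fold-fixed g k e)) e

fold-injective : ∀ {A : Set} (g : A → A) → Injective _≡_ _≡_ g →
  ∀ k → Injective _≡_ _≡_ (λ x → fold x g k)
fold-injective g inj zero    e = e
fold-injective g inj (suc k) e = fold-injective g inj k (inj e)

-- Orbits of an injection on n points have length at most n, which divides n!.
fold-! : ∀ {n} (g : Fin n → Fin n) → Injective _≡_ _≡_ g → ∀ x → fold x g (n !) ≡ x
fold-! {n} g inj x
  with i , j , i<j , e ← pigeonhole (ℕₚ.n<1+n n) (λ i → fold x g (toℕ i))
  = returns (toℕ j ∸ toℕ i) (ℕₚ.m<n⇒0<n∸m i<j)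
      (ℕₚ.≤-trans (ℕₚ.m∸n≤m (toℕ j) (toℕ i)) (ℕₚ.≤-pred (toℕ<n j)))
      (fold-injective g inj (toℕ i) (begin
        fold (fold x g (toℕ j ∸ toℕ i)) g (toℕ i) ≡⟨ fold-+ x g (toℕ i) ⟨
        fold x g (toℕ i + (toℕ j ∸ toℕ i))        ≡⟨ cong (fold x g) (ℕₚ.m+[n∸m]≡n (ℕₚ.<⇒≤ i<j)) ⟩
        fold x g (toℕ j)                          ≡⟨ e ⟨
        fold x g (toℕ i)                          ∎))
  where
  open ≡-Reasoning
  returns : ∀ d → 0 < d → d ≤ n → fold x g d ≡ x → fold x g (n !) ≡ x
  returns (suc d) _ d≤n e with divides q eq ← ∣-trans (m∣m*n {suc d} (d !)) (m≤n⇒m!∣n! d≤n) =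
    trans (cong (fold x g) eq) (trans (fold-*-pointwise g x q (suc d)) (fold-fixed _ q e))

halve : ∀ k → ∃[ h ] (k ≡ h + h ⊎ k ≡ suc (h * 2))
halve zero = 0 , inj₁ refl
halve (suc k) with halve k
... | h , inj₁ e = h , inj₂ (cong suc (trans e (trans (cong (h +_) (sym (ℕₚ.+-identityʳ h))) (ℕₚ.*-comm 2 h))))
... | h , inj₂ e = suc h , inj₁ (cong suc (trans e (trans (cong suc (trans (ℕₚ.*-comm h 2) (cong (h +_) (ℕₚ.+-identityʳ h)))) (sym (ℕₚ.+-suc h h)))))

oddPart : ∀ k → 0 < k → ∃[ m ] ∃[ q ] k ≡ 2 ^ m * suc (q * 2)
oddPart k = go k k ℕₚ.≤-refl
  where
  go : ∀ fuel k → k ≤ fuel → 0 < k → ∃[ m ] ∃[ q ] k ≡ 2 ^ m * suc (q * 2)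
  go zero k k≤0 0<k = contradiction k≤0 (ℕₚ.<⇒≱ 0<k)
  go (suc fuel) k k≤ 0<k with halve k
  ... | q , inj₂ e = 0 , q , trans e (sym (ℕₚ.+-identityʳ _))
  ... | zero , inj₁ e = contradiction (sym e) (ℕₚ.<⇒≢ 0<k)
  ... | suc h , inj₁ refl
    with m , q , e ← go fuel (suc h) (ℕₚ.≤-trans (ℕₚ.m≤n+m (suc h) h) (ℕₚ.≤-pred k≤)) (s≤s z≤n) =
    suc m , q , (begin
      suc h + suc h                 ≡⟨ cong (suc h +_) (ℕₚ.+-identityʳ (suc h)) ⟨
      2 * suc h                     ≡⟨ cong (2 *_) e ⟩
      2 * (2 ^ m * suc (q * 2))     ≡⟨ ℕₚ.*-assoc 2 (2 ^ m) (suc (q * 2)) ⟨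
      2 ^ suc m * suc (q * 2)       ∎)
    where open ≡-Reasoning

least : ∀ {P : ℕ → Set} → (∀ j → Dec (P j)) → ∀ m → P m →
  ∃[ j ] (P j × ∀ i → i < j → ¬ P i)
least P? m pm with P? 0
least P? m       pm | yes p0 = 0 , p0 , λ i ()
least P? zero    pm | no ¬p0 = contradiction pm ¬p0
least P? (suc m) pm | no ¬p0
  with j , pj , min ← least (P? ∘ suc) m pm = suc j , pj , below
  where
  below : ∀ i → i < suc j → ¬ _
  below zero    _         = ¬p0
  below (suc i) (s≤s i<j) = min i i<j

-- Maps that preserve or reverse adjacency

Preserves : ∀ {n} → Graph n → (Fin n → Fin n) → Set
Preserves G g = ∀ x y → adj G (g x) (g y) ≡ adj G x y

Reverses : ∀ {n} → Graph n → (Fin n → Fin n) → Set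
Reverses G g = ∀ x y → x ≢ y → adj G (g x) (g y) ≡ not (adj G x y)

reverses-twice : ∀ {n} (G : Graph n) {g} → Injective _≡_ _≡_ g → Reverses G g → Preserves G (g ∘ g)
reverses-twice G {g} inj rev x y with x ≟ y
... | yes refl = trans (irrefl G (g (g x))) (sym (irrefl G x))
... | no x≢y   = trans (rev (g x) (g y) (x≢y ∘ inj)) (trans (cong not (rev x y x≢y)) (not-involutive _))

preserves-fold : ∀ {n} (G : Graph n) {g} → Preserves G g → ∀ k → Preserves G (λ x → fold x g k)
preserves-fold G pres zero    x y = refl
preserves-fold G pres (suc k) x y = trans (pres _ _) (preserves-fold G pres k x y)

-- Given a reversing map of 2-power order, the level of a vertex is the binary
-- logarithm of its cycle length, and its mate is the antipode on that cycle.
module Antipode {n} (G : Graph n) (ρ : Fin n → Fin n) (ρ-inj : Injective _≡_ _≡_ ρ)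
  (ρ-rev : Reverses G ρ) (m : ℕ) (ρ-order : ∀ x → fold x ρ (2 ^ m) ≡ x) where

  -- The power of `ρ` with exponent `2 ^ j`, built by repeated squaring so that its properties
  -- follow by recursion on `j`.
  τ : ℕ → Fin n → Fin n
  τ zero    x = ρ x
  τ (suc j) x = τ j (τ j x)

  τ-fold : ∀ j x → τ j x ≡ fold x ρ (2 ^ j)
  τ-fold zero    x = refl
  τ-fold (suc j) x = begin
    τ j (τ j x)                        ≡⟨ τ-fold j (τ j x) ⟩
    fold (τ j x) ρ (2 ^ j)             ≡⟨ cong (λ y → fold y ρ (2 ^ j)) (τ-fold j x) ⟩
    fold (fold x ρ (2 ^ j)) ρ (2 ^ j)  ≡⟨ fold-+ x ρ (2 ^ j) ⟨
    fold x ρ (2 ^ j + 2 ^ j)           ≡⟨ cong (λ k → fold x ρ (2 ^ j + k)) (ℕₚ.+-identityʳ (2 ^ j)) ⟨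
    fold x ρ (2 ^ suc j)               ∎
    where open ≡-Reasoning

  τ-inj : ∀ j → Injective _≡_ _≡_ (τ j)
  τ-inj zero    e = ρ-inj e
  τ-inj (suc j) e = τ-inj j (τ-inj j e)

  τ-commutes : ∀ j (g : Fin n → Fin n) → (∀ x → g (ρ x) ≡ ρ (g x)) → ∀ x → g (τ j x) ≡ τ j (g x)
  τ-commutes zero    g c x = c x
  τ-commutes (suc j) g c x = trans (τ-commutes j g c (τ j x)) (cong (τ j) (τ-commutes j g c x))

  τ-comm : ∀ i j x → τ i (τ j x) ≡ τ j (τ i x)
  τ-comm i j = τ-commutes j (τ i) (λ x → sym (τ-commutes i ρ (λ _ → refl) x))

  -- Even powers of a reversing map preserve adjacency; the index starts at 1 because `τ zero` is
  -- `ρ` itself.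
  τ-preserves : ∀ j → Preserves G (τ (suc j))
  τ-preserves zero        = reverses-twice G ρ-inj ρ-rev
  τ-preserves (suc j) x y = trans (τ-preserves j _ _) (τ-preserves j x y)

  τ-fixes-later : ∀ {i k x} → i ≤ k → τ i x ≡ x → τ k x ≡ x
  τ-fixes-later {i} {k} {x} i≤k e = go (ℕₚ.≤⇒≤′ i≤k)
    where
    go : ∀ {k} → i ≤′ k → τ k x ≡ x
    go ≤′-refl = e
    go (≤′-step {k} p) = trans (cong (τ k) (go p)) (go p)

  IsLevel : Fin n → ℕ → Set
  IsLevel x j = τ j x ≡ x × ∀ i → i < j → τ i x ≢ x

  level-of : ∀ x → ∃[ j ] IsLevel x j
  level-of x = least (λ j → τ j x ≟ x) m (trans (τ-fold m x) (ρ-order x))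

  IsLevel-unique : ∀ {x j k} → IsLevel x j → IsLevel x k → j ≡ k
  IsLevel-unique (ej , mj) (ek , mk) =
    ℕₚ.≤-antisym (ℕₚ.≮⇒≥ (λ lt → mj _ lt ek)) (ℕₚ.≮⇒≥ (λ lt → mk _ lt ej))

  -- An orbit {x , ρ x} of size two would be both an edge and a non-edge.
  level≢1 : ∀ {x} → ¬ IsLevel x 1
  level≢1 {x} (e , min) = not-¬ refl (begin
    adj G x (ρ x)          ≡⟨ adj-sym G x (ρ x) ⟩
    adj G (ρ x) x          ≡⟨ cong (adj G (ρ x)) e ⟨
    adj G (ρ x) (ρ (ρ x))  ≡⟨ ρ-rev x (ρ x) (λ p → min 0 (s≤s z≤n) (sym p)) ⟩
    not (adj G x (ρ x))    ∎)
    where open ≡-Reasoning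

  -- On a cycle of length `2 ^ suc j`, `τ j` moves half way round; a fixed point of `ρ` is its own
  -- antipode.
  antipode : ℕ → Fin n → Fin n
  antipode zero    x = x
  antipode (suc j) x = τ j x

  antipode-invol : ∀ j {x} → τ j x ≡ x → antipode j (antipode j x) ≡ x
  antipode-invol zero    e = refl
  antipode-invol (suc j) e = e

  antipode-level : ∀ j {x k} → IsLevel x k → IsLevel (antipode j x) k
  antipode-level zero    l = l
  antipode-level (suc j) {x} {k} (e , min) =
    trans (τ-comm k j x) (cong (τ j) e) ,
    λ i i<k e′ → min i i<k (τ-inj j (trans (τ-comm j i x) e′))

  -- Level 1 does not occur, so at a positive level the antipode is taken by an even power of `ρ`.
  -- This power preserves adjacency and fixes all vertices of lower level.
  antipode-lower : ∀ {x y j k} → IsLevel x j → IsLevel y k → k < j → adj G y x ≡ adj G y (antipode j x)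
  antipode-lower {j = 1} lx ly _ = ⊥-elim (level≢1 lx)
  antipode-lower {x} {y} {suc (suc j)} lx (ey , _) (s≤s k≤j) =
    trans (sym (τ-preserves j y x)) (cong (λ z → adj G z (τ (suc j) x)) (τ-fixes-later k≤j ey))

  antipode-same : ∀ {x j} y → IsLevel x j → adj G y x ≡ adj G (antipode j y) (antipode j x)
  antipode-same {j = zero}            y lx = refl
  antipode-same {j = 1}               y lx = ⊥-elim (level≢1 lx)
  antipode-same {x} {j = suc (suc j)} y lx = sym (τ-preserves j y x)

  antipode-fixed : ∀ {x j} → IsLevel x j → antipode j x ≡ x → j ≡ 0
  antipode-fixed {j = zero}  l e         = refl
  antipode-fixed {j = suc j} (_ , min) e = contradiction e (min j (ℕₚ.n<1+n j))

  pairing : Pairing G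
  pairing = record
    { mate          = mate
    ; lev           = lev
    ; mate-invol    = λ x → trans (cong (λ j → antipode j (mate x)) (lev-mate x))
                                  (antipode-invol (lev x) (proj₁ (isLevel x)))
    ; lev-mate      = lev-mate
    ; lower         = λ x y → antipode-lower (isLevel x) (isLevel y)
    -- Equal levels turn `antipode (lev x) y` into the mate of `y`.
    ; level         = λ x y e → trans (antipode-same y (isLevel x))
                                  (cong (λ j → adj G (antipode j y) (mate x)) (sym e))
    ; fixed-level-0 = fixed-level-0
    ; fixed-unique  = fixed-unique
    }
    where
    lev : Fin n → ℕ
    lev x = proj₁ (level-of x)

    isLevel : ∀ x → IsLevel x (lev x)
    isLevel x = proj₂ (level-of x)

    mate : Fin n → Fin n
    mate x = antipode (lev x) x

    lev-mate : ∀ x → lev (mate x) ≡ lev x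
    lev-mate x = IsLevel-unique (isLevel (mate x)) (antipode-level (lev x) (isLevel x))

    fixed-level-0 : ∀ x → mate x ≡ x → lev x ≡ 0
    fixed-level-0 x = antipode-fixed (isLevel x)

    ρ-fixed : ∀ x → mate x ≡ x → ρ x ≡ x
    ρ-fixed x e = proj₁ (subst (IsLevel x) (fixed-level-0 x e) (isLevel x))

    -- Two distinct fixed points of `ρ` would form a pair that is mapped to itself with its
    -- adjacency negated.
    fixed-unique : ∀ x y → mate x ≡ x → mate y ≡ y → x ≡ y
    fixed-unique x y ex ey = decidable-stable (x ≟ y) λ x≢y →
      not-¬ refl (trans (sym (cong₂ (adj G) (ρ-fixed x ex) (ρ-fixed y ey))) (ρ-rev x y x≢y))

perm-injective : ∀ {n} (σ : Permutation′ n) → Injective _≡_ _≡_ (σ ⟨$⟩ʳ_)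
perm-injective σ = Injection.injective (↔⇒↣ σ)

selfComplementary-reverses : ∀ {n} (G : Graph n) ((σ , _) : SelfComplementary G) → Reverses G (σ ⟨$⟩ʳ_)
selfComplementary-reverses G (σ , co) x y x≢y = trans (sym (not-involutive _)) (cong not
  (trans (cong (_∧ not (adj G (σ ⟨$⟩ʳ x) (σ ⟨$⟩ʳ y))) (sym (≢-not (x≢y ∘ perm-injective σ)))) (co x y)))

-- An odd power of a complementing permutation is complementing; the odd part of its
-- order is removed in this way.
selfComplementary-pairing : ∀ {n} (G : Graph n) → SelfComplementary G → Pairing G
selfComplementary-pairing {n} G sc@(σ , _)
  with m , q , e ← oddPart (n !) (ℕₚ.1≤n! n) = Antipode.pairing G ρ ρ-inj ρ-rev m ρ-order
  where
  s : Fin n → Fin n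
  s = σ ⟨$⟩ʳ_
  s-inj : Injective _≡_ _≡_ s
  s-inj = perm-injective σ
  s-rev : Reverses G s
  s-rev = selfComplementary-reverses G sc

  ρ : Fin n → Fin n
  ρ x = fold x s (suc (q * 2))

  ρ-inj : Injective _≡_ _≡_ ρ
  ρ-inj = fold-injective s s-inj (suc (q * 2))

  even : Preserves G (λ x → fold x s (q * 2))
  even x y = trans (cong₂ (adj G) (fold-*-pointwise s x q 2) (fold-*-pointwise s y q 2))
    (preserves-fold G (reverses-twice G s-inj s-rev) q x y)

  ρ-rev : Reverses G ρ
  ρ-rev x y x≢y = trans (s-rev _ _ (x≢y ∘ fold-injective s s-inj (q * 2))) (cong not (even x y))

  ρ-order : ∀ x → fold x ρ (2 ^ m) ≡ x
  -- By `e` the exponents multiply to `n !`, and this power of `s` is the identity.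
  ρ-order x = trans (sym (fold-*-pointwise s x (2 ^ m) (suc (q * 2))))
    (trans (cong (fold x s) (sym e)) (fold-! s s-inj x))

-- The common discrepancy

true-ext : ∀ {x y} → (x ≡ true → y ≡ true) → (y ≡ true → x ≡ true) → x ≡ y
true-ext {false} {false} _ _ = refl
true-ext {false} {true}  _ h = h refl
true-ext {true}          h _ = sym (h refl)

degree : ∀ {n} → Graph n → Fin n → ℕ
degree G x = countFin (adj G x)

codegree : ∀ {n} → Graph n → Fin n → ℕ
codegree G x = countFin (coAdj G x)

degree-codegree : ∀ {n} (G : Graph (suc n)) x → degree G x + codegree G x ≡ n
degree-codegree {n} G x = ℕₚ.suc-injective (begin
  suc (degree G x + codegree G x)
    ≡⟨ cong₂ _+_ (sym (∑-singleton x)) (cong₂ _+_ (countFin-∑ (adj G x)) (countFin-∑ (coAdj G x))) ⟩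
  ∑ (λ y → χ ⌊ y ≟ x ⌋) + (∑ (χ ∘ adj G x) + ∑ (χ ∘ coAdj G x))
    ≡⟨ cong (∑ (λ y → χ ⌊ y ≟ x ⌋) +_) (∑-distrib-+ (χ ∘ adj G x) (χ ∘ coAdj G x)) ⟨
  ∑ (λ y → χ ⌊ y ≟ x ⌋) + ∑ (λ y → χ (adj G x y) + χ (coAdj G x y))
    ≡⟨ ∑-distrib-+ (λ y → χ ⌊ y ≟ x ⌋) (λ y → χ (adj G x y) + χ (coAdj G x y)) ⟨
  ∑ (λ y → χ ⌊ y ≟ x ⌋ + (χ (adj G x y) + χ (coAdj G x y)))
    ≡⟨ sum-cong-≗ one ⟩
  ∑ {suc n} (λ _ → 1)
    ≡⟨ ∑-const (suc n) 1 ⟩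
  suc n * 1
    ≡⟨ ℕₚ.*-identityʳ (suc n) ⟩
  suc n ∎)
  where
  open ≡-Reasoning
  one : ∀ y → χ ⌊ y ≟ x ⌋ + (χ (adj G x y) + χ (coAdj G x y)) ≡ 1
  one y with y ≟ x
  ... | yes refl rewrite irrefl G x | ≟-complete {x = x} refl = refl
  ... | no y≢x rewrite ≢-complete (≢-sym y≢x) with adj G x y
  ...   | true  = refl
  ...   | false = refl

degree-constant : ∀ {n} (G : Graph n) → VertexTransitive G → ∀ x y → degree G x ≡ degree G y
degree-constant G vt x y with σ , aut , refl ← vt x y =
  sym (trans (count-permute (adj G (σ ⟨$⟩ʳ x)) σ) (count-cong (aut x)))

codegree-image : ∀ {n} (G : Graph n) ((σ , _) : SelfComplementary G) x →
  codegree G (σ ⟨$⟩ʳ x) ≡ degree G x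
codegree-image G (σ , co) x =
  trans (count-permute (coAdj G (σ ⟨$⟩ʳ x)) σ) (count-cong (co x))

discrepancy-sym : ∀ {n} (G : Graph n) u v → discrepancy G u v ≡ discrepancy G v u
discrepancy-sym G u v = count-cong λ w → true-ext (flip w) (flip w)
  where
  flip : ∀ {u v} w → distinguishes G u v w ≡ true → distinguishes G v u w ≡ true
  flip w e = let w≢u , w≢v , ne = distinguishes-sound G w e in
    distinguishes-complete G w w≢v w≢u (≢-sym ne)

-- Used with `φ = id` for automorphisms and `φ = not` for complementing permutations: an injective
-- `φ` does not affect whether two adjacencies differ.
discrepancy-invariant : ∀ {n} (G : Graph n) (σ : Permutation′ n) (φ : Bool → Bool) →
  Injective _≡_ _≡_ φ → (∀ x y → x ≢ y → adj G (σ ⟨$⟩ʳ x) (σ ⟨$⟩ʳ y) ≡ φ (adj G x y)) →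
  ∀ u v → discrepancy G (σ ⟨$⟩ʳ u) (σ ⟨$⟩ʳ v) ≡ discrepancy G u v
discrepancy-invariant G σ φ φ-inj h u v =
  trans (count-permute (distinguishes G (s u) (s v)) σ) (count-cong λ w → true-ext (back w) (forth w))
  where
  s = σ ⟨$⟩ʳ_
  back : ∀ w → distinguishes G (s u) (s v) (s w) ≡ true → distinguishes G u v w ≡ true
  back w e =
    let w≢u , w≢v , ne = distinguishes-sound G (s w) e
        w≢u = w≢u ∘ cong s
        w≢v = w≢v ∘ cong s
    in distinguishes-complete G w w≢u w≢v
         (λ e → ne (trans (h u w (≢-sym w≢u)) (trans (cong φ e) (sym (h v w (≢-sym w≢v))))))
  forth : ∀ w → distinguishes G u v w ≡ true → distinguishes G (s u) (s v) (s w) ≡ true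
  forth w e =
    let w≢u , w≢v , ne = distinguishes-sound G w e in
    distinguishes-complete G (s w) (w≢u ∘ perm-injective σ) (w≢v ∘ perm-injective σ)
      (λ e → ne (φ-inj (trans (sym (h u w (≢-sym w≢u))) (trans e (h v w (≢-sym w≢v))))))

-- The complementing permutation sends a non-adjacent pair to an edge, and edge-transitivity
-- compares edges. The automorphism may exchange the two ends, hence the use of symmetry.
discrepancy-constant : ∀ {n} (G : Graph n) → SelfComplementary G → EdgeTransitive G →
  ∀ {u v x y} → u ≢ v → x ≢ y → discrepancy G u v ≡ discrepancy G x y
discrepancy-constant {n} G sc@(σ , _) et {u} {v} {x} {y} u≢v x≢y =
  let u′ , v′ , uv , eq  = toEdge u v u≢v
      x′ , y′ , xy , eq′ = toEdge x y x≢y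
  in trans eq (trans (edges u′ v′ x′ y′ uv xy) (sym eq′))
  where
  edges : ∀ u v x y → adj G u v ≡ true → adj G x y ≡ true → discrepancy G u v ≡ discrepancy G x y
  edges u v x y uv xy with et u v x y uv xy
  ... | α , aut , inj₁ (refl , refl) = sym (discrepancy-invariant G α id id (λ a b _ → aut a b) u v)
  ... | α , aut , inj₂ (refl , refl) =
    trans (sym (discrepancy-invariant G α id id (λ a b _ → aut a b) u v))
      (discrepancy-sym G (α ⟨$⟩ʳ u) (α ⟨$⟩ʳ v))

  toEdge : ∀ u v → u ≢ v → ∃[ u′ ] ∃[ v′ ] (adj G u′ v′ ≡ true × discrepancy G u v ≡ discrepancy G u′ v′)
  toEdge u v u≢v = by-colour (adj G u v) refl
    where
    rev = selfComplementary-reverses G sc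
    by-colour : ∀ c → adj G u v ≡ c → ∃[ u′ ] ∃[ v′ ] (adj G u′ v′ ≡ true × discrepancy G u v ≡ discrepancy G u′ v′)
    by-colour true  e = u , v , e , refl
    by-colour false e = σ ⟨$⟩ʳ u , σ ⟨$⟩ʳ v , trans (rev u v u≢v) (cong not e) ,
      sym (discrepancy-invariant G σ not not-injective rev u v)

-- Count the pairs (v , w) such that w distinguishes the vertex 0 from v: there are d for
-- every v ≠ 0, and r for every w ≠ 0, namely the non-neighbours or the neighbours of w.
discrepancy-sum : ∀ {n} (G : Graph (suc n)) {d r} → (∀ x → degree G x ≡ r) → (∀ x → codegree G x ≡ r) →
  (∀ i → discrepancy G zero (suc i) ≡ d) → n * d ≡ n * r
discrepancy-sum {n} G {d} {r} deg codeg D = begin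
  n * d                                                        ≡⟨ ∑-const n d ⟨
  ∑ {n} (λ _ → d)                                              ≡⟨ cong₂ _+_ row₀ (sum-cong-≗ (λ i → trans (sym (countFin-∑ (distinguishes G zero (suc i)))) (D i))) ⟨
  ∑ (λ v → ∑ (λ w → χ (distinguishes G zero v w)))             ≡⟨ ∑-comm (λ v w → χ (distinguishes G zero v w)) ⟩
  ∑ (λ w → ∑ (λ v → χ (distinguishes G zero v w)))             ≡⟨ cong₂ _+_ column₀ (sum-cong-≗ (λ i → trans (sym (countFin-∑ (λ v → distinguishes G zero v (suc i)))) (column i))) ⟩
  ∑ {n} (λ _ → r)                                              ≡⟨ ∑-const n r ⟩
  n * r                                                        ∎
  where
  open ≡-Reasoning
  row₀ : ∑ (λ w → χ (distinguishes G zero zero w)) ≡ 0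
  row₀ = ∑-zero λ w → χ-≢true λ e → proj₂ (proj₂ (distinguishes-sound G {zero} {zero} w e)) refl

  column₀ : ∑ (λ v → χ (distinguishes G zero v zero)) ≡ 0
  column₀ = ∑-zero λ v → χ-≢true λ e → proj₁ (distinguishes-sound G {zero} {v} zero e) refl

  column : ∀ i → countFin (λ v → distinguishes G zero v (suc i)) ≡ r
  column i = by-colour (adj G zero (suc i)) refl
    where
    w = suc i
    by-colour : ∀ c → adj G zero w ≡ c → countFin (λ v → distinguishes G zero v w) ≡ r
    by-colour true e = trans (count-cong eq) (codeg w)
      where
      eq : ∀ v → distinguishes G zero v w ≡ coAdj G w v
      -- The test of `w` against `zero` computes away because `w` is a successor, and `true xor c`
      -- is `not c`.
      eq v = cong₂ (λ c c′ → not ⌊ w ≟ v ⌋ ∧ (c xor c′)) e (adj-sym G v w)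
    by-colour false e = trans (count-cong eq) (deg w)
      where
      eq : ∀ v → distinguishes G zero v w ≡ adj G w v
      eq v = trans (cong₂ (λ c c′ → not ⌊ w ≟ v ⌋ ∧ (c xor c′)) e (adj-sym G v w)) (strip (w ≟ v))
        where
        strip : (d : Dec (w ≡ v)) → not ⌊ d ⌋ ∧ adj G w v ≡ adj G w v
        strip (yes refl) = sym (irrefl G w)
        strip (no _)     = refl

discrepancy-degree : ∀ {n} (G : Graph (suc n)) {r} → SelfComplementary G → EdgeTransitive G →
  (∀ x → degree G x ≡ r) → (∀ x → codegree G x ≡ r) → ∀ u v → u ≢ v → discrepancy G u v ≡ r
discrepancy-degree {zero}  G sc et deg codeg zero zero u≢v = contradiction refl u≢v
discrepancy-degree {suc n} G sc et deg codeg u v u≢v = ℕₚ.*-cancelˡ-≡ _ _ (suc n)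
  (discrepancy-sum G deg codeg (λ i → discrepancy-constant G sc et {zero} {suc i} {u} {v} (λ ()) u≢v))

-- Twin-width and first contractions under constant discrepancy

discrepancy-tww : ∀ {n} (G : Graph (suc n)) {r} → (∀ u v → u ≢ v → discrepancy G u v ≡ r) →
  n ≡ r + r → Pairing G → IsTww G r × IsLb1 G r
-- With a single vertex, `n ≡ r + r` forces `r` to be 0.
discrepancy-tww {zero} G {zero} D n≡r+r P =
  (Contract.contraction G P 0 n≡r+r D , λ _ _ _ → z≤n) , (λ _ → refl) , λ ()
discrepancy-tww {suc n} G {r} D n≡r+r P =
  (Contract.contraction G P r n≡r+r D ,
    width-lower G (λ u v u≢v → ℕₚ.≤-reflexive (sym (D u v u≢v)))) ,
  (λ ()) ,
  λ _ → (zero , suc zero , (λ ()) , lb zero (suc zero) (λ ())) ,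
        λ u v u≢v → ℕₚ.≤-reflexive (sym (lb u v u≢v))
  where
  lb : ∀ u v → u ≢ v → maxRedDegree G (mergePair u v) ≡ r
  lb u v u≢v = trans (maxRedDegree-mergePair G u v u≢v) (D u v u≢v)

theorem4p7 : ∀ {n : ℕ} (G : Graph (suc n)) →
    SelfComplementary G → EdgeTransitive G → VertexTransitive G →
    ∃[ t ] (IsTww G t × IsLb1 G t)
theorem4p7 {n} G sc@(σ , _) et vt = 
  r , discrepancy-tww G (discrepancy-degree G sc et deg codeg) n≡r+r (selfComplementary-pairing G sc)
  where
  r = degree G zero

  deg : ∀ x → degree G x ≡ r
  deg x = degree-constant G vt x zero

  n≡r+r : n ≡ r + r
  -- At the image of `zero` under `σ` the degree is `r` by vertex-transitivity, and the codegree
  -- equals the degree of `zero`, again `r`.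
  n≡r+r = trans (sym (degree-codegree G (σ ⟨$⟩ʳ zero)))
    (cong₂ _+_ (deg (σ ⟨$⟩ʳ zero)) (codegree-image G sc zero))

  codeg : ∀ x → codegree G x ≡ r
  codeg x = ℕₚ.+-cancelˡ-≡ r _ _
    (trans (cong (_+ codegree G x) (sym (deg x))) (trans (degree-codegree G x) n≡r+r))
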